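{- For every $n\ge 0$ and $k\ge 0$, the number of partitions $\lambda$ of $n$ with pairing index $T(\lambda)=k$ equals the number of partitions of $n$ into exactly $k$ parts.
   Context: For an integer partition $\lambda$, pair equal parts of $\lambda$ as far as possible: for each part size occurring with odd multiplicity exactly one copy remains unpaired, and a part size of even multiplicity is completely paired. Let $r(\lambda)$ be the largest part size that participates in at least one pair (i.e. the largest part size of multiplicity at least $2$), with $r(\lambda)=0$ if $\lambda$ has distinct parts. Write the unpaired parts (the part sizes of odd multiplicity, each once) in decreasing order $u_1>u_2>\cdots>u_s$ and let $s(\lambda)=u_1-u_2+u_3-u_4+\cdots$ (so $s(\lambda)=0$ if there are no unpaired parts). The pairing index of $\lambda$ is $T(\lambda)=r(\lambda)+s(\lambda)$. -}

module Defs where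

open import Data.Fin.Base using (Fin)
open import Data.Integer.Base as ℤ using (ℤ; +_)
open import Data.List.Base using (List; []; _∷_; length; filter; deduplicate)
open import Data.List.Extrema.Nat using (max)
open import Data.List.Relation.Unary.All using (All)
open import Data.List.Relation.Unary.Linked using (Linked)
open import Data.Nat.Base using (ℕ; _≥_; _>_)
open import Data.Nat.DivMod using (_%_)
open import Data.Nat.ListAction using (sum)
open import Data.Nat.Properties using (_≟_; _≤?_)
open import Function.Bundles using (_↔_)
open import Relation.Binary.PropositionalEquality.Core using (_≡_)

-- All three proof fields are propositions, so two partitions are
-- propositionally equal exactly when their lists of parts are.
record Partition (n : ℕ) : Set where
  field
    parts      : List ℕ
    decreasing : Linked _≥_ parts
    positive   : All (_> 0) parts
    sum-parts  : sum parts ≡ n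

open Partition public

multiplicity : ℕ → List ℕ → ℕ
multiplicity x xs = length (filter (x ≟_) xs)

pairedParts : List ℕ → List ℕ
pairedParts xs = filter (λ x → 2 ≤? multiplicity x xs) xs

-- Both operations preserve the order of the list, so for a partition the
-- result is strictly decreasing.
unpairedParts : List ℕ → List ℕ
unpairedParts xs =
  deduplicate _≟_ (filter (λ x → multiplicity x xs % 2 ≟ 1) xs)

-- u₁ - (u₂ - (u₃ - …)) = u₁ - u₂ + u₃ - …
alternatingSum : List ℕ → ℤ
alternatingSum []       = + 0
alternatingSum (u ∷ us) = + u ℤ.- alternatingSum us

module _ {n : ℕ} (p : Partition n) where

  numberOfParts : ℕ
  numberOfParts = length (parts p)

  -- The first argument of max is its value on the empty list.
  r : ℕ
  r = max 0 (pairedParts (parts p))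

  s : ℤ
  s = alternatingSum (unpairedParts (parts p))

  pairingIndex : ℤ
  pairingIndex = + r ℤ.+ s

-- A is finite with exactly N elements.
HasCardinality : ∀ {a} → Set a → ℕ → Set a
HasCardinality A N = A ↔ Fin N

{-# OPTIONS --safe #-}
-- A partition λ is μ ∪ μ ∪ ν with ν the strict partition of unpaired parts.
-- Conjugation turns the largest part r of μ into the number of parts of μ′,
-- and Sylvester's bijection turns ν into a partition into odd parts whose number
-- of parts is the alternating sum s of ν.  Doubling the parts of μ′ gives r even
-- parts; together with the s odd parts they form an arbitrary partition of n
-- into r + s parts, which is split again by parity.
module Submission where

open import Defs
open import Axiom.UniquenessOfIdentityProofs using (module Decidable⇒UIP)
open import Data.Bool.Base using (true; false)
import Data.Fin.Base as Fin
open import Data.Integer.Base using (+_)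
import Data.Integer.Base as ℤ
import Data.Integer.Properties as ℤₚ
import Data.Integer.Tactic.RingSolver as ℤ-solver
open import Data.List.Base hiding (sum; merge)
open import Data.List.Extrema.Nat using (max; max-mono-⊆; max≈v⁺)
open import Data.List.Membership.Propositional using (_∈_; _∉_)
open import Data.List.Membership.Propositional.Properties
  using (∈-filter⁺; ∈-filter⁻; ∈-deduplicate⁺; ∈-deduplicate⁻; ∈-lookup; ∈-upTo⁺;
         ∈-cartesianProductWith⁺)
open import Data.List.Properties
  using (filter-++; filter-some; filter-all; filter-none; filter-accept; filter-reject;
         length-++; length-map; length-replicate; map-∘; map-id-local; ++-identityʳ; ≡-dec)
open import Data.List.Relation.Binary.Permutation.Propositional
  using (_↭_; ↭-refl; ↭-reflexive; ↭-sym; ↭-trans; prep)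
open import Data.List.Relation.Binary.Permutation.Propositional.Properties
  using (All-resp-↭; filter-↭; shift; ↭-length; ++-comm)
open import Data.List.Relation.Unary.All as All using (All; []; _∷_)
import Data.List.Relation.Unary.All.Properties as Allₚ
open import Data.List.Relation.Unary.AllPairs as AllPairs using (AllPairs; []; _∷_)
import Data.List.Relation.Unary.AllPairs.Properties as AllPairsₚ
open import Data.List.Relation.Unary.Any as Any using (here; there)
open import Data.List.Relation.Unary.Any.Properties using (lookup-index)
open import Data.List.Relation.Unary.Linked as Linked using (Linked)
open import Data.List.Relation.Unary.Linked.Properties using (AllPairs⇒Linked; Linked⇒AllPairs)
open import Data.List.Relation.Unary.Unique.DecPropositional.Properties using (deduplicate-!)
open import Data.List.Relation.Unary.Unique.Propositional using (Unique)
import Data.List.Relation.Unary.Unique.Propositional.Properties as Uniqueₚ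
open import Data.Nat.Base
open import Data.Nat.DivMod using (_%_; m%n<n)
open import Data.Nat.ListAction using (sum)
open import Data.Nat.ListAction.Properties using (sum-↭; sum-++)
open import Data.Nat.Properties
open import Data.Nat.Tactic.RingSolver using (solve-∀)
open import Data.Product.Base using (Σ-syntax; ∃-syntax; _×_; _,_; proj₁; proj₂)
open import Function.Base using (_∘_; flip)
open import Function.Bundles using (_↔_; mk↔ₛ′)
open import Function.Construct.Composition using (_↔-∘_)
import Relation.Binary.Construct.Flip.EqAndOrd as Flip
open import Relation.Binary.Definitions using (DecidableEquality)
open import Relation.Binary.PropositionalEquality
open import Relation.Nullary using (Dec; yes; no; ¬_; contradiction; does; _×-dec_)
import Relation.Unary as U
open import Relation.Unary.Properties using (∁?)
open import Data.List.Sort (Flip.decTotalOrder ≤-decTotalOrder) using (sort; sort-↭; sort-↗)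

-- An alternating sum can count rows because `x - y` is a number of rows. Peel the two outer hooks
-- `x > y` off a centred diagram with odd rows: the rows that vanish are the top row and the rows of
-- a single cell, and these number exactly `x - y`. The recursion of `toOdd` takes two parts at a
-- time for this reason, and `x ∸ suc y` is the number of rows of size 1 to restore. Both
-- recombinations, `merge` and `join`, end in a sort, which erases the visible structure of their
-- result. Their inverse laws are therefore proved through invariants that determine a decreasing
-- list: multiplicities for the pairing, permutations for the parity. The pairing index is an
-- integer, and it turns out nonnegative only because it equals a number of parts. The common
-- cardinality is obtained on the side of the number of parts, where enumeration is direct.

private variable
  a b x y z n k : ℕ
  as xs ys κ ω μ ν : List ℕ

Decreasing StrictlyDecreasing : List ℕ → Set
Decreasing = AllPairs _≥_
StrictlyDecreasing = AllPairs _>_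

-- Multiplicities determine a decreasing list

multiplicity-≡ : ∀ x xs → multiplicity x (x ∷ xs) ≡ suc (multiplicity x xs)
multiplicity-≡ x xs = cong length (filter-accept (x ≟_) {xs = xs} refl)

multiplicity-≢ : ∀ xs → z ≢ x → multiplicity z (x ∷ xs) ≡ multiplicity z xs
multiplicity-≢ {z} xs z≢x = cong length (filter-reject (z ≟_) {xs = xs} z≢x)

multiplicity-++ : ∀ z xs ys → multiplicity z (xs ++ ys) ≡ multiplicity z xs + multiplicity z ys
multiplicity-++ z xs ys =
  trans (cong length (filter-++ (z ≟_) xs ys)) (length-++ (filter (z ≟_) xs))

multiplicity-↭ : ∀ z → xs ↭ ys → multiplicity z xs ≡ multiplicity z ys
multiplicity-↭ z xs↭ys = ↭-length (filter-↭ (z ≟_) xs↭ys)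

∈⇒0<multiplicity : z ∈ xs → 0 < multiplicity z xs
∈⇒0<multiplicity {z} = filter-some (z ≟_)

∉⇒multiplicity≡0 : z ∉ xs → multiplicity z xs ≡ 0
∉⇒multiplicity≡0 {z} z∉xs = cong length (filter-none (z ≟_) (Allₚ.¬Any⇒All¬ _ z∉xs))

0<multiplicity⇒∈ : ∀ xs → 0 < multiplicity z xs → z ∈ xs
0<multiplicity⇒∈ {z} xs 0<m with Any.any? (z ≟_) xs
... | yes z∈xs = z∈xs
... | no  z∉xs = contradiction (∉⇒multiplicity≡0 z∉xs) (>⇒≢ 0<m)

Unique⇒multiplicity≤1 : ∀ z → Unique xs → multiplicity z xs ≤ 1
Unique⇒multiplicity≤1 z [] = z≤n
Unique⇒multiplicity≤1 {x ∷ xs} z (x≢ ∷ u) with z ≟ x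
... | no z≢x rewrite multiplicity-≢ xs z≢x = Unique⇒multiplicity≤1 z u
... | yes refl rewrite multiplicity-≡ x xs | ∉⇒multiplicity≡0 (Allₚ.All¬⇒¬Any x≢) = ≤-refl

head-≤-head : All (y ≥_) ys → multiplicity x (x ∷ xs) ≡ multiplicity x (y ∷ ys) → x ≤ y
head-≤-head {y} {ys} {x} {xs} y≥ eq = All.lookup (≤-refl ∷ y≥)
  (0<multiplicity⇒∈ (y ∷ ys) (subst (0 <_) (trans (sym (multiplicity-≡ x xs)) eq) z<s))

-- Each head is the maximum of its list and occurs in the other list, so the heads agree; removing
-- them lowers the same multiplicity on both sides. Equalities of sorted lists thereby become
-- arithmetic, one part size at a time.
multiplicity-injective : Decreasing xs → Decreasing ys →
  (∀ z → multiplicity z xs ≡ multiplicity z ys) → xs ≡ ys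
multiplicity-injective {[]} {[]} _ _ _ = refl
multiplicity-injective {[]} {y ∷ ys} _ _ eq =
  contradiction (trans (eq y) (multiplicity-≡ y ys)) 0≢1+n
multiplicity-injective {x ∷ xs} {[]} _ _ eq =
  contradiction (trans (sym (eq x)) (multiplicity-≡ x xs)) 0≢1+n
multiplicity-injective {x ∷ xs} {y ∷ ys} (x≥ ∷ dxs) (y≥ ∷ dys) eq
  with refl ← ≤-antisym (head-≤-head {xs = xs} y≥ (eq x)) (head-≤-head {xs = ys} x≥ (sym (eq y)))
  = cong (x ∷_) (multiplicity-injective dxs dys tails≡)
  where
  tails≡ : ∀ z → multiplicity z xs ≡ multiplicity z ys
  tails≡ z with z ≟ x
  ... | yes refl = suc-injective
    (trans (sym (multiplicity-≡ x xs)) (trans (eq x) (multiplicity-≡ x ys)))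
  ... | no z≢x = trans (sym (multiplicity-≢ xs z≢x)) (trans (eq z) (multiplicity-≢ ys z≢x))

↭⇒≡ : Decreasing xs → Decreasing ys → xs ↭ ys → xs ≡ ys
↭⇒≡ dxs dys xs↭ys = multiplicity-injective dxs dys (λ z → multiplicity-↭ z xs↭ys)

sort-decreasing : ∀ xs → Decreasing (sort xs)
sort-decreasing xs = Linked⇒AllPairs (flip ≤-trans) (sort-↗ xs)

-- Pairs and unpaired parts

-- Counting copies from the end of the list, every second one represents a pair.
halves : List ℕ → List ℕ
halves [] = []
halves (x ∷ xs) with multiplicity x xs % 2 ≟ 1
... | yes _ = x ∷ halves xs
... | no  _ = halves xs

halves-All : ∀ {P : ℕ → Set} → All P xs → All P (halves xs)
halves-All [] = []
halves-All {x ∷ xs} (px ∷ pxs) with multiplicity x xs % 2 ≟ 1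
... | yes _ = px ∷ halves-All pxs
... | no  _ = halves-All pxs

halves-decreasing : Decreasing xs → Decreasing (halves xs)
halves-decreasing [] = []
halves-decreasing {x ∷ xs} (x≥ ∷ d) with multiplicity x xs % 2 ≟ 1
... | yes _ = halves-All x≥ ∷ halves-decreasing d
... | no  _ = halves-decreasing d

⌊1+n/2⌋-odd : ∀ n → n % 2 ≡ 1 → ⌊ suc n /2⌋ ≡ suc ⌊ n /2⌋
⌊1+n/2⌋-odd 1 _ = refl
⌊1+n/2⌋-odd (suc (suc n)) odd = cong suc (⌊1+n/2⌋-odd n odd)

⌊1+n/2⌋-even : ∀ n → n % 2 ≢ 1 → ⌊ suc n /2⌋ ≡ ⌊ n /2⌋
⌊1+n/2⌋-even 0 _ = refl
⌊1+n/2⌋-even 1 even = contradiction refl even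
⌊1+n/2⌋-even (suc (suc n)) even = cong suc (⌊1+n/2⌋-even n even)

-- A copy is kept exactly when an odd number `m` of copies follows it, which is exactly when passing
-- from `m` to `suc m` increases `⌊ m /2⌋`.
multiplicity-halves : ∀ z xs → multiplicity z (halves xs) ≡ ⌊ multiplicity z xs /2⌋
multiplicity-halves z [] = refl
multiplicity-halves z (x ∷ xs) with multiplicity x xs % 2 ≟ 1 | z ≟ x | multiplicity-halves z xs
... | yes odd | yes refl | ih = begin
  multiplicity x (x ∷ halves xs)    ≡⟨ multiplicity-≡ x (halves xs) ⟩
  suc (multiplicity x (halves xs))  ≡⟨ cong suc ih ⟩
  suc ⌊ multiplicity x xs /2⌋       ≡⟨ ⌊1+n/2⌋-odd _ odd ⟨
  ⌊ suc (multiplicity x xs) /2⌋     ≡⟨ cong ⌊_/2⌋ (multiplicity-≡ x xs) ⟨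
  ⌊ multiplicity x (x ∷ xs) /2⌋     ∎
  where open ≡-Reasoning
... | no even | yes refl | ih = begin
  multiplicity x (halves xs)        ≡⟨ ih ⟩
  ⌊ multiplicity x xs /2⌋           ≡⟨ ⌊1+n/2⌋-even _ even ⟨
  ⌊ suc (multiplicity x xs) /2⌋     ≡⟨ cong ⌊_/2⌋ (multiplicity-≡ x xs) ⟨
  ⌊ multiplicity x (x ∷ xs) /2⌋     ∎
  where open ≡-Reasoning
... | yes _ | no z≢x | ih = trans (multiplicity-≢ (halves xs) z≢x)
  (trans ih (cong ⌊_/2⌋ (sym (multiplicity-≢ xs z≢x))))
... | no _  | no z≢x | ih = trans ih (cong ⌊_/2⌋ (sym (multiplicity-≢ xs z≢x)))

-- The bracketing follows `μ ++ μ ++ ν` in `merge`: two copies of the halves, and the remainder for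
-- the unpaired part.
double-half+rem : ∀ n → ⌊ n /2⌋ + (⌊ n /2⌋ + n % 2) ≡ n
double-half+rem 0 = refl
double-half+rem 1 = refl
double-half+rem (suc (suc n)) = begin
  suc (⌊ n /2⌋ + suc (⌊ n /2⌋ + n % 2))    ≡⟨ cong suc (+-suc ⌊ n /2⌋ _) ⟩
  suc (suc (⌊ n /2⌋ + (⌊ n /2⌋ + n % 2)))  ≡⟨ cong suc (cong suc (double-half+rem n)) ⟩
  suc (suc n)                              ∎
  where open ≡-Reasoning

⌊2m+b/2⌋ : ∀ m {b} → b ≤ 1 → ⌊ m + (m + b) /2⌋ ≡ m
⌊2m+b/2⌋ zero    z≤n       = refl
⌊2m+b/2⌋ zero    (s≤s z≤n) = refl
⌊2m+b/2⌋ (suc m) {b} b≤1 rewrite +-suc m (m + b) = cong suc (⌊2m+b/2⌋ m b≤1)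

2m+b%2 : ∀ m {b} → b ≤ 1 → (m + (m + b)) % 2 ≡ b
2m+b%2 zero    z≤n       = refl
2m+b%2 zero    (s≤s z≤n) = refl
2m+b%2 (suc m) {b} b≤1 rewrite +-suc m (m + b) = 2m+b%2 m b≤1

oddMultiplicity? : ∀ xs x → Dec (multiplicity x xs % 2 ≡ 1)
oddMultiplicity? xs x = multiplicity x xs % 2 ≟ 1

-- After deduplication every multiplicity is 0 or 1, so membership alone decides it, and membership
-- means odd multiplicity.
multiplicity-unpairedParts : ∀ z xs → multiplicity z (unpairedParts xs) ≡ multiplicity z xs % 2
multiplicity-unpairedParts z xs with oddMultiplicity? xs z
... | yes odd = trans (≤-antisym
  (Unique⇒multiplicity≤1 z (deduplicate-! _≟_ (filter (oddMultiplicity? xs) xs)))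
  (∈⇒0<multiplicity z∈)) (sym odd)
  where
  z∈xs : z ∈ xs
  z∈xs = 0<multiplicity⇒∈ xs (n≢0⇒n>0 λ m≡0 → 0≢1+n (trans (sym (cong (_% 2) m≡0)) odd))
  z∈ : z ∈ unpairedParts xs
  z∈ = ∈-deduplicate⁺ _≟_ (∈-filter⁺ (oddMultiplicity? xs) z∈xs odd)
... | no even = trans (∉⇒multiplicity≡0 z∉)
  (sym (n<1⇒n≡0 (≤∧≢⇒< (s≤s⁻¹ (m%n<n (multiplicity z xs) 2)) even)))
  where
  z∉ : z ∉ unpairedParts xs
  z∉ z∈ = even (proj₂ (∈-filter⁻ (oddMultiplicity? xs) {xs = xs} (∈-deduplicate⁻ _≟_ _ z∈)))

unpairedParts-All : ∀ {P : ℕ → Set} xs → All P xs → All P (unpairedParts xs)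
unpairedParts-All xs pxs = Allₚ.deduplicate⁺ _≟_ (Allₚ.filter⁺ (oddMultiplicity? xs) pxs)

deduplicate-decreasing : Decreasing xs → Decreasing (deduplicate _≟_ xs)
deduplicate-decreasing [] = []
deduplicate-decreasing (x≥ ∷ d) =
  Allₚ.filter⁺ _ (Allₚ.deduplicate⁺ _≟_ x≥) ∷ AllPairsₚ.filter⁺ _ (deduplicate-decreasing d)

unpairedParts-strict : ∀ xs → Decreasing xs → StrictlyDecreasing (unpairedParts xs)
unpairedParts-strict xs d = AllPairs.zipWith (λ { (y≤x , x≢y) → ≤∧≢⇒< y≤x (x≢y ∘ sym) })
  (deduplicate-decreasing (AllPairsₚ.filter⁺ (oddMultiplicity? xs) d) , deduplicate-! _≟_ _)

strict⇒decreasing : StrictlyDecreasing xs → Decreasing xs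
strict⇒decreasing = AllPairs.map <⇒≤

strict⇒unique : StrictlyDecreasing xs → Unique xs
strict⇒unique = AllPairs.map >⇒≢

merge : List ℕ → List ℕ → List ℕ
merge μ ν = sort (μ ++ μ ++ ν)

multiplicity-merge : ∀ z μ ν → multiplicity z (merge μ ν) ≡
  multiplicity z μ + (multiplicity z μ + multiplicity z ν)
multiplicity-merge z μ ν = begin
  multiplicity z (sort (μ ++ μ ++ ν))   ≡⟨ multiplicity-↭ z (sort-↭ (μ ++ μ ++ ν)) ⟩
  multiplicity z (μ ++ μ ++ ν)          ≡⟨ multiplicity-++ z μ (μ ++ ν) ⟩
  multiplicity z μ + multiplicity z (μ ++ ν)
    ≡⟨ cong (_+_ (multiplicity z μ)) (multiplicity-++ z μ ν) ⟩
  multiplicity z μ + (multiplicity z μ + multiplicity z ν) ∎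
  where open ≡-Reasoning

merge-halves-unpairedParts : Decreasing xs → merge (halves xs) (unpairedParts xs) ≡ xs
merge-halves-unpairedParts {xs} d = multiplicity-injective (sort-decreasing _) d λ z → begin
  multiplicity z (merge (halves xs) (unpairedParts xs))
    ≡⟨ multiplicity-merge z (halves xs) (unpairedParts xs) ⟩
  multiplicity z (halves xs) + (multiplicity z (halves xs) + multiplicity z (unpairedParts xs))
    ≡⟨ cong₂ (λ m b → m + (m + b)) (multiplicity-halves z xs) (multiplicity-unpairedParts z xs) ⟩
  ⌊ multiplicity z xs /2⌋ + (⌊ multiplicity z xs /2⌋ + multiplicity z xs % 2)
    ≡⟨ double-half+rem (multiplicity z xs) ⟩
  multiplicity z xs ∎
  where open ≡-Reasoning

halves-merge : Decreasing μ → StrictlyDecreasing ν → halves (merge μ ν) ≡ μ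
halves-merge {μ} {ν} dμ dν =
  multiplicity-injective (halves-decreasing (sort-decreasing _)) dμ λ z → begin
    multiplicity z (halves (merge μ ν)) ≡⟨ multiplicity-halves z (merge μ ν) ⟩
    ⌊ multiplicity z (merge μ ν) /2⌋    ≡⟨ cong ⌊_/2⌋ (multiplicity-merge z μ ν) ⟩
    ⌊ multiplicity z μ + (multiplicity z μ + multiplicity z ν) /2⌋
      ≡⟨ ⌊2m+b/2⌋ (multiplicity z μ) (Unique⇒multiplicity≤1 z (strict⇒unique dν)) ⟩
    multiplicity z μ ∎
  where open ≡-Reasoning

unpairedParts-merge : StrictlyDecreasing ν → unpairedParts (merge μ ν) ≡ ν
unpairedParts-merge {ν} {μ} dν =
  multiplicity-injective
    (strict⇒decreasing (unpairedParts-strict (merge μ ν) (sort-decreasing _)))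
    (strict⇒decreasing dν) λ z → begin
    multiplicity z (unpairedParts (merge μ ν)) ≡⟨ multiplicity-unpairedParts z (merge μ ν) ⟩
    multiplicity z (merge μ ν) % 2             ≡⟨ cong (_% 2) (multiplicity-merge z μ ν) ⟩
    (multiplicity z μ + (multiplicity z μ + multiplicity z ν)) % 2
      ≡⟨ 2m+b%2 (multiplicity z μ) (Unique⇒multiplicity≤1 z (strict⇒unique dν)) ⟩
    multiplicity z ν ∎
  where open ≡-Reasoning

sum-merge : ∀ μ ν → sum (merge μ ν) ≡ sum μ + (sum μ + sum ν)
sum-merge μ ν = begin
  sum (sort (μ ++ μ ++ ν))   ≡⟨ sum-↭ (sort-↭ (μ ++ μ ++ ν)) ⟩
  sum (μ ++ μ ++ ν)          ≡⟨ sum-++ μ (μ ++ ν) ⟩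
  sum μ + sum (μ ++ ν)       ≡⟨ cong (_+_ (sum μ)) (sum-++ μ ν) ⟩
  sum μ + (sum μ + sum ν)    ∎
  where open ≡-Reasoning

0<⌊n/2⌋⇒2≤n : ∀ n → 0 < ⌊ n /2⌋ → 2 ≤ n
0<⌊n/2⌋⇒2≤n (suc (suc n)) _ = s≤s (s≤s z≤n)

-- The two lists repeat their entries differently, but they have the same set of entries, and `max`
-- depends only on that set.
max-pairedParts : ∀ xs → max 0 (pairedParts xs) ≡ max 0 (halves xs)
max-pairedParts xs = ≤-antisym (max-mono-⊆ ≤-refl ⊆₁) (max-mono-⊆ ≤-refl ⊆₂)
  where
  paired? : ∀ x → Dec (2 ≤ multiplicity x xs)
  paired? x = 2 ≤? multiplicity x xs
  ⊆₁ : ∀ {z} → z ∈ pairedParts xs → z ∈ halves xs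
  ⊆₁ {z} z∈ = 0<multiplicity⇒∈ (halves xs) (subst (0 <_) (sym (multiplicity-halves z xs))
    (⌊n/2⌋-mono (proj₂ (∈-filter⁻ paired? {xs = xs} z∈))))
  ⊆₂ : ∀ {z} → z ∈ halves xs → z ∈ pairedParts xs
  ⊆₂ {z} z∈ = ∈-filter⁺ paired? (0<multiplicity⇒∈ xs (<-trans z<s 2≤)) 2≤
    where
    2≤ : 2 ≤ multiplicity z xs
    2≤ = 0<⌊n/2⌋⇒2≤n _ (subst (0 <_) (multiplicity-halves z xs) (∈⇒0<multiplicity z∈))

-- Conjugation

-- The list holds the rows of a Young diagram, read as continued by empty rows; a new leftmost
-- column of height `x` lengthens the top `x` rows.
addColumn : ℕ → List ℕ → List ℕ
addColumn zero    ys       = ys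
addColumn (suc x) []       = 1 ∷ addColumn x []
addColumn (suc x) (y ∷ ys) = suc y ∷ addColumn x ys

conjugate : List ℕ → List ℕ
conjugate = foldr addColumn []

length-addColumn : ∀ x ys → length ys ≤ x → length (addColumn x ys) ≡ x
length-addColumn zero    []       _   = refl
length-addColumn (suc x) []       _   = cong suc (length-addColumn x [] z≤n)
length-addColumn (suc x) (y ∷ ys) len = cong suc (length-addColumn x ys (s≤s⁻¹ len))

sum-addColumn : ∀ x ys → sum (addColumn x ys) ≡ x + sum ys
sum-addColumn zero    ys       = refl
sum-addColumn (suc x) []       = cong suc (sum-addColumn x [])
sum-addColumn (suc x) (y ∷ ys) = cong suc (begin
  y + sum (addColumn x ys) ≡⟨ cong (_+_ y) (sum-addColumn x ys) ⟩
  y + (x + sum ys)         ≡⟨ +-assoc y x _ ⟨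
  y + x + sum ys           ≡⟨ cong (_+ sum ys) (+-comm y x) ⟩
  x + y + sum ys           ≡⟨ +-assoc x y _ ⟩
  x + (y + sum ys)         ∎)
  where open ≡-Reasoning

addColumn-positive : ∀ x → All (_> 0) ys → All (_> 0) (addColumn x ys)
addColumn-positive zero    ps       = ps
addColumn-positive (suc x) []       = z<s ∷ addColumn-positive x []
addColumn-positive (suc x) (_ ∷ ps) = z<s ∷ addColumn-positive x ps

addColumn-≤ : ∀ x → All (_≤ b) ys → All (_≤ suc b) (addColumn x ys)
addColumn-≤ zero    ≤b         = All.map m≤n⇒m≤1+n ≤b
addColumn-≤ (suc x) []         = s≤s z≤n ∷ addColumn-≤ x []
addColumn-≤ (suc x) (y≤b ∷ ≤b) = s≤s y≤b ∷ addColumn-≤ x ≤b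

addColumn-decreasing : ∀ x → Decreasing ys → Decreasing (addColumn x ys)
addColumn-decreasing zero    d        = d
addColumn-decreasing (suc x) []       = addColumn-≤ x [] ∷ addColumn-decreasing x []
addColumn-decreasing (suc x) (y≥ ∷ d) = addColumn-≤ x y≥ ∷ addColumn-decreasing x d

sum-conjugate : ∀ xs → sum (conjugate xs) ≡ sum xs
sum-conjugate []       = refl
sum-conjugate (x ∷ xs) =
  trans (sum-addColumn x (conjugate xs)) (cong (_+_ x) (sum-conjugate xs))

conjugate-positive : ∀ xs → All (_> 0) (conjugate xs)
conjugate-positive []       = []
conjugate-positive (x ∷ xs) = addColumn-positive x (conjugate-positive xs)

conjugate-decreasing : ∀ xs → Decreasing (conjugate xs)
conjugate-decreasing []       = []
conjugate-decreasing (x ∷ xs) = addColumn-decreasing x (conjugate-decreasing xs)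

-- Decreasing parts mean that each inserted column is at least as tall as the diagram so far, so its
-- height becomes the number of rows.
length-conjugate-≤ : Decreasing xs → All (_≤ b) xs → length (conjugate xs) ≤ b
length-conjugate-≤ []       []        = z≤n
length-conjugate-≤ {x ∷ xs} (x≥ ∷ d) (x≤b ∷ _) =
  ≤-trans (≤-reflexive (length-addColumn x _ (length-conjugate-≤ d x≥))) x≤b

length-conjugate : Decreasing xs → length (conjugate xs) ≡ max 0 xs
length-conjugate []                = refl
length-conjugate {x ∷ xs} (x≥ ∷ d) =
  trans (length-addColumn x _ (length-conjugate-≤ d x≥))
        (sym (max≈v⁺ (here refl) (≤-refl ∷ x≥) z≤n))

-- Induction on the height peels off the top row `suc y`, which becomes a column of the conjugate:
-- it adds 1 to the leading part and contributes `y` to the rest. The induction starts at height 1,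
-- since at height 0 the right side would carry a part 0 that `conjugate` never produces.
conjugate-addColumn : ∀ x ys → 0 < x → length ys ≤ x →
  conjugate (addColumn x ys) ≡ x ∷ conjugate ys
conjugate-addColumn 1             []       _ _   = refl
conjugate-addColumn (suc (suc x)) []       _ _
  rewrite conjugate-addColumn (suc x) [] z<s z≤n = refl
conjugate-addColumn 1             (y ∷ []) _ _   = refl
conjugate-addColumn 1             (_ ∷ _ ∷ _) _ (s≤s ())
conjugate-addColumn (suc (suc x)) (y ∷ ys) _ len
  rewrite conjugate-addColumn (suc x) ys z<s (s≤s⁻¹ len) = refl

conjugate-involutive : Decreasing xs → All (_> 0) xs → conjugate (conjugate xs) ≡ xs
conjugate-involutive []       []       = refl
conjugate-involutive {x ∷ xs} (x≥ ∷ d) (x>0 ∷ ps) =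
  trans (conjugate-addColumn x (conjugate xs) x>0 (length-conjugate-≤ d x≥))
        (cong (x ∷_) (conjugate-involutive d ps))

-- Sylvester's bijection between strict partitions and partitions into odd parts

-- In terms of the rows `2a + 1` recorded by `a`: every row regains the two cells lost to the
-- central column and its left neighbour, and `z` rows of one cell are put back.
raise : List ℕ → ℕ → List ℕ
raise as z = map suc as ++ replicate z 0

lower : List ℕ → List ℕ
lower []           = []
lower (zero ∷ _)   = []
lower (suc a ∷ as) = a ∷ lower as

length-raise : ∀ as z → length (raise as z) ≡ length as + z
length-raise as z = begin
  length (map suc as ++ replicate z 0)           ≡⟨ length-++ (map suc as) ⟩
  length (map suc as) + length (replicate z 0)   ≡⟨ cong₂ _+_ (length-map suc as) (length-replicate z) ⟩
  length as + z                                  ∎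
  where open ≡-Reasoning

lower-raise : ∀ as z → lower (raise as z) ≡ as
lower-raise []       zero    = refl
lower-raise []       (suc z) = refl
lower-raise (a ∷ as) z       = cong (a ∷_) (lower-raise as z)

length-lower-≤ : ∀ as → length (lower as) ≤ length as
length-lower-≤ []           = z≤n
length-lower-≤ (zero ∷ as)  = z≤n
length-lower-≤ (suc a ∷ as) = s≤s (length-lower-≤ as)

raise-[] : All (_≤ 0) as → replicate (length as) 0 ≡ as
raise-[] []           = refl
raise-[] (z≤n ∷ as≤0) = cong (0 ∷_) (raise-[] as≤0)

-- In a decreasing list the zeros stand at the end, so `lower` loses only their number, which the
-- two lengths recover.
raise-lower : Decreasing as → raise (lower as) (length as ∸ length (lower as)) ≡ as
raise-lower {[]}         []         = refl
raise-lower {zero ∷ as}  (as≤0 ∷ _) = cong (0 ∷_) (raise-[] as≤0)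
raise-lower {suc a ∷ as} (_ ∷ d)    = cong (suc a ∷_) (raise-lower d)

lower-≤ : All (_≤ suc b) as → All (_≤ b) (lower as)
lower-≤ {as = []}         []           = []
lower-≤ {as = zero ∷ _}   _            = []
lower-≤ {as = suc a ∷ as} (s≤s p ∷ ps) = p ∷ lower-≤ ps

lower-decreasing : Decreasing as → Decreasing (lower as)
lower-decreasing {[]}         []       = []
lower-decreasing {zero ∷ as}  _        = []
lower-decreasing {suc a ∷ as} (a≥ ∷ d) = lower-≤ a≥ ∷ lower-decreasing d

raise-≤ : ∀ z → All (_< b) as → All (_≤ b) (raise as z)
raise-≤ z <b = Allₚ.++⁺ (Allₚ.map⁺ <b) (Allₚ.replicate⁺ z z≤n)

raise-decreasing : ∀ z → Decreasing as → Decreasing (raise as z)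
raise-decreasing {as} z d = AllPairsₚ.++⁺ (AllPairsₚ.map⁺ (AllPairs.map s≤s d)) (zeros z)
  (Allₚ.map⁺ (All.universal (λ _ → Allₚ.replicate⁺ z z≤n) as))
  where
  zeros : ∀ z → Decreasing (replicate z 0)
  zeros zero    = []
  zeros (suc z) = Allₚ.replicate⁺ z z≤n ∷ zeros z

-- Sylvester's fish-hooks: an odd part 2a + 1 is recorded as a.  Drawing the
-- rows 2a + 1 centred, the first two parts x, y of the strict partition are
-- the hooks "central column, then right half of the first row" and "left half
-- of the first row, then first column left of the centre"; the rest of the
-- diagram is again centred, with rows 2(a - 1) + 1 for the lower rows a > 0.
toOdd : List ℕ → List ℕ
toOdd []          = []
toOdd (x ∷ [])    = replicate x 0
toOdd (x ∷ y ∷ ν) = y ∸ length (toOdd ν) ∷ raise (toOdd ν) (x ∸ suc y)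

-- The first argument bounds the recursion depth; length as is enough.
fromOdd : ℕ → List ℕ → List ℕ
fromOdd _       []           = []
fromOdd zero    (_ ∷ _)      = []
fromOdd (suc k) (zero ∷ as)  = suc (length as) ∷ []
fromOdd (suc k) (suc a ∷ as) =
  suc (suc (a + length as)) ∷ suc (a + length (lower as)) ∷ fromOdd k (lower as)

oddPart : ℕ → ℕ
oddPart a = suc (a + a)

length-≤ : All (λ a → a + length as ≤ b) as → length as ≤ b
length-≤ {[]}     []      = z≤n
length-≤ {a ∷ as} (p ∷ _) = ≤-trans (m≤n+m _ a) p

length-toOdd-∷∷ : ∀ x y ν → length (toOdd (x ∷ y ∷ ν)) ≡ suc (length (toOdd ν) + (x ∸ suc y))
length-toOdd-∷∷ x y ν = cong suc (length-raise (toOdd ν) (x ∸ suc y))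

-- The sum is largest at the first entry, where it is the length of the outer hook, that is, the
-- largest part of `ν`. A free bound `b` in place of that part also covers empty `ν`.
toOdd-bound : StrictlyDecreasing ν → All (_≤ b) ν →
  All (λ a → a + length (toOdd ν) ≤ b) (toOdd ν)
-- The strict inequality leaves room for the increment in `raise`: the raised entries stay below the
-- new head `y ∸ length (toOdd ν)`, and that subtraction is not truncated.
toOdd-next : StrictlyDecreasing (y ∷ ν) → All (λ a → a + length (toOdd ν) < y) (toOdd ν)

toOdd-next {zero}  {[]}    _         = []
toOdd-next {zero}  {_ ∷ _} ((() ∷ _) ∷ _)
toOdd-next {suc y}         (y> ∷ dν) = All.map s≤s (toOdd-bound dν (All.map s≤s⁻¹ y>))

length-toOdd-≤ : StrictlyDecreasing (y ∷ ν) → length (toOdd ν) ≤ y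
length-toOdd-≤ d = length-≤ (All.map <⇒≤ (toOdd-next d))

-- With `s` lower rows of more than one cell, the top row is recorded by `y ∸ s` and there are
-- `x ∸ suc y` single cells, so this is half the top row plus the central column.
firstHook : ∀ s → s ≤ y → y < x → y ∸ s + suc (s + (x ∸ suc y)) ≡ x
firstHook {y} {x} s s≤y y<x = begin
  y ∸ s + suc (s + (x ∸ suc y))   ≡⟨ +-suc (y ∸ s) _ ⟩
  suc (y ∸ s + (s + (x ∸ suc y))) ≡⟨ cong suc (+-assoc (y ∸ s) s _) ⟨
  suc (y ∸ s + s + (x ∸ suc y))   ≡⟨ cong (λ m → suc (m + (x ∸ suc y))) (m∸n+n≡m s≤y) ⟩
  suc y + (x ∸ suc y)             ≡⟨ m+[n∸m]≡n y<x ⟩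
  x                               ∎
  where open ≡-Reasoning

toOdd-rest-≤ : ∀ z → StrictlyDecreasing (y ∷ ν) →
  All (_≤ y ∸ length (toOdd ν)) (raise (toOdd ν) z)
toOdd-rest-≤ {y} {ν} z d =
  raise-≤ z (All.map (λ {a} → m+n≤o⇒m≤o∸n (suc a)) (toOdd-next d))

toOdd-bound [] _ = []
toOdd-bound {x ∷ []} _ (x≤b ∷ _) =
  Allₚ.replicate⁺ x (≤-trans (≤-reflexive (length-replicate x)) x≤b)
toOdd-bound {x ∷ y ∷ ν} {b} ((y<x ∷ _) ∷ d) (x≤b ∷ _) =
  top ∷ All.map (λ c≤ → ≤-trans (+-monoˡ-≤ _ c≤) top) (toOdd-rest-≤ (x ∸ suc y) d)
  where
  top : y ∸ length (toOdd ν) + length (toOdd (x ∷ y ∷ ν)) ≤ b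
  top rewrite length-toOdd-∷∷ x y ν | firstHook (length (toOdd ν)) (length-toOdd-≤ d) y<x = x≤b

toOdd-decreasing : StrictlyDecreasing ν → Decreasing (toOdd ν)
toOdd-decreasing []                            = []
toOdd-decreasing {x ∷ []}    _                 = raise-decreasing x []
toOdd-decreasing {x ∷ y ∷ ν} (_ ∷ d@(_ ∷ dν)) =
  toOdd-rest-≤ (x ∸ suc y) d ∷ raise-decreasing (x ∸ suc y) (toOdd-decreasing dν)

alternatingSum-toOdd : StrictlyDecreasing ν → alternatingSum ν ≡ + length (toOdd ν)
alternatingSum-toOdd [] = refl
alternatingSum-toOdd {x ∷ []} _ =
  trans (ℤₚ.+-identityʳ (+ x)) (cong +_ (sym (length-replicate x)))
alternatingSum-toOdd {x ∷ y ∷ ν} ((y<x ∷ _) ∷ _ ∷ dν) = begin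
  + x ℤ.- (+ y ℤ.- alternatingSum ν)
    -- Writing `x` as `suc y + d` removes the truncated subtraction and leaves a ring identity over
    -- the integers.
    ≡⟨ cong₂ (λ m A → + m ℤ.- (+ y ℤ.- A)) (sym (m+[n∸m]≡n y<x)) (alternatingSum-toOdd dν) ⟩
  (+ 1 ℤ.+ + y ℤ.+ + d) ℤ.- (+ y ℤ.- + s′)   ≡⟨ cancel (+ y) (+ d) (+ s′) ⟩
  + suc (s′ + d)                             ≡⟨ cong +_ (length-toOdd-∷∷ x y ν) ⟨
  + length (toOdd (x ∷ y ∷ ν))              ∎
  where
  open ≡-Reasoning
  d s′ : ℕ
  d = x ∸ suc y
  s′ = length (toOdd ν)
  cancel : ∀ y d s′ → (+ 1 ℤ.+ y ℤ.+ d) ℤ.- (y ℤ.- s′) ≡ + 1 ℤ.+ (s′ ℤ.+ d)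
  cancel = ℤ-solver.solve-∀

sum-oddPart-zeros : ∀ z → sum (map oddPart (replicate z 0)) ≡ z
sum-oddPart-zeros zero    = refl
sum-oddPart-zeros (suc z) = cong suc (sum-oddPart-zeros z)

-- Adding 1 to an entry adds 2 to the odd part it records, and an appended 0 records a part 1.
sum-oddPart-raise : ∀ as z →
  sum (map oddPart (raise as z)) ≡ sum (map oddPart as) + (length as + length as + z)
sum-oddPart-raise []       z = sum-oddPart-zeros z
sum-oddPart-raise (a ∷ as) z rewrite sum-oddPart-raise as z =
  shuffle a (sum (map oddPart as)) (length as) z
  where
  shuffle : ∀ a m l z → suc (suc a + suc a) + (m + (l + l + z)) ≡
    suc (a + a) + m + (suc l + suc l + z)
  shuffle = solve-∀

sum-toOdd : StrictlyDecreasing ν → sum (map oddPart (toOdd ν)) ≡ sum ν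
sum-toOdd [] = refl
sum-toOdd {x ∷ []} _ = trans (sum-oddPart-zeros x) (sym (+-identityʳ x))
sum-toOdd {x ∷ y ∷ ν} ((y<x ∷ _) ∷ d@(_ ∷ dν)) = begin
  oddPart c + sum (map oddPart (raise (toOdd ν) d′))
    ≡⟨ cong (_+_ (oddPart c)) (sum-oddPart-raise (toOdd ν) d′) ⟩
  oddPart c + (sum (map oddPart (toOdd ν)) + (s′ + s′ + d′))
    ≡⟨ cong (λ m → oddPart c + (m + (s′ + s′ + d′))) (sum-toOdd dν) ⟩
  oddPart c + (sum ν + (s′ + s′ + d′))         ≡⟨ shuffle c s′ d′ (sum ν) ⟩
  (c + suc (s′ + d′)) + ((c + s′) + sum ν)
    ≡⟨ cong₂ (λ m n → m + (n + sum ν)) (firstHook s′ (length-toOdd-≤ d) y<x)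
                                          (m∸n+n≡m (length-toOdd-≤ d)) ⟩
  x + (y + sum ν)                           ∎
  where
  open ≡-Reasoning
  s′ c d′ : ℕ
  s′ = length (toOdd ν)
  c = y ∸ s′
  d′ = x ∸ suc y
  shuffle : ∀ c s′ d′ m → suc (c + c) + (m + (s′ + s′ + d′)) ≡ (c + suc (s′ + d′)) + ((c + s′) + m)
  shuffle = solve-∀

-- Makes the head `y ∸ length (toOdd ν)` positive; a positive head is how `fromOdd` recognises that
-- there is a second hook.
length-toOdd-< : 0 < y → StrictlyDecreasing (y ∷ ν) → length (toOdd ν) < y
length-toOdd-< {suc y} _ d = s≤s (length-≤ (All.map s≤s⁻¹ (toOdd-next d)))

fromOdd-∷-raise : ∀ k low z → 0 < a → fromOdd (suc k) (a ∷ raise low z) ≡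
  a + suc (length low + z) ∷ a + length low ∷ fromOdd k low
fromOdd-∷-raise {suc a} k low z _
  rewrite lower-raise low z | length-raise low z | +-suc a (length low + z) = refl

fromOdd-toOdd : ∀ k → StrictlyDecreasing ν → All (_> 0) ν → length (toOdd ν) ≤ k →
  fromOdd k (toOdd ν) ≡ ν
fromOdd-toOdd _ [] _ _ = refl
fromOdd-toOdd {suc x ∷ []} (suc k) _ _ _ = cong (λ m → suc m ∷ []) (length-replicate x)
fromOdd-toOdd {x ∷ y ∷ ν} (suc k) ((y<x ∷ _) ∷ d@(_ ∷ dν)) (_ ∷ y>0 ∷ ν>0) len≤ = begin
  fromOdd (suc k) (toOdd (x ∷ y ∷ ν))
    ≡⟨ fromOdd-∷-raise k (toOdd ν) (x ∸ suc y) (m<n⇒0<n∸m (length-toOdd-< y>0 d)) ⟩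
  y ∸ s′ + suc (s′ + (x ∸ suc y)) ∷ y ∸ s′ + s′ ∷ fromOdd k (toOdd ν)
    ≡⟨ cong₂ _∷_ (firstHook s′ (length-toOdd-≤ d) y<x)
         (cong₂ _∷_ (m∸n+n≡m (length-toOdd-≤ d)) (fromOdd-toOdd k dν ν>0 s′≤k)) ⟩
  x ∷ y ∷ ν ∎
  where
  open ≡-Reasoning
  s′ : ℕ
  s′ = length (toOdd ν)
  s′≤k : s′ ≤ k
  s′≤k = ≤-trans (m≤m+n s′ _) (s≤s⁻¹ (≤-trans (≤-reflexive (sym (length-toOdd-∷∷ x y ν))) len≤))

toOdd-fromOdd : ∀ k → Decreasing as → length as ≤ k → toOdd (fromOdd k as) ≡ as
toOdd-fromOdd _ [] _ = refl
toOdd-fromOdd {zero ∷ as} (suc k) (as≤0 ∷ _) _ = cong (0 ∷_) (raise-[] as≤0)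
toOdd-fromOdd {suc a ∷ as} (suc k) (_ ∷ d) (s≤s len≤)
  rewrite toOdd-fromOdd k (lower-decreasing d) (≤-trans (length-lower-≤ as) len≤)
        -- The difference `x ∸ suc y` of the two rebuilt hooks reduces to this form; cancelling `a`
        -- leaves the number of zeros of `as`, as `raise-lower` requires.
        | [m+n]∸[m+o]≡n∸o a (length as) (length (lower as))
        = cong₂ _∷_ (m+n∸n≡m (suc a) (length (lower as))) (raise-lower d)

-- No hook exceeds the largest entry plus the number of rows. Applied to `lower as`, whose entries
-- are at most `a` below a head `suc a`, this puts all later hooks strictly below the second one.
fromOdd-≤ : ∀ k → All (_≤ b) as → All (_≤ b + length as) (fromOdd k as)
fromOdd-≤ _ [] = []
fromOdd-≤ zero (_ ∷ _) = []
fromOdd-≤ {b} {zero ∷ as} (suc k) _ = m≤n+m _ b ∷ []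
fromOdd-≤ {suc b} {suc a ∷ as} (suc k) (s≤s a≤b ∷ as≤) =
  s≤s (≤-trans (≤-reflexive (sym (+-suc a _))) (+-monoˡ-≤ _ a≤b)) ∷
  s≤s (+-mono-≤ a≤b (m≤n⇒m≤1+n (length-lower-≤ as))) ∷
  All.map (λ c≤ → ≤-trans c≤ (+-mono-≤ (n≤1+n b) (m≤n⇒m≤1+n (length-lower-≤ as))))
          (fromOdd-≤ k (lower-≤ as≤))

fromOdd-strict : ∀ k → Decreasing as → StrictlyDecreasing (fromOdd k as)
fromOdd-strict _ [] = []
fromOdd-strict zero (_ ∷ _) = []
fromOdd-strict {zero ∷ as} (suc k) _ = [] ∷ []
fromOdd-strict {suc a ∷ as} (suc k) (a≥ ∷ d) =
  (second< ∷ All.map (λ c< → <-trans c< second<) rest<) ∷ rest< ∷ fromOdd-strict k (lower-decreasing d)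
  where
  second< : suc (a + length (lower as)) < suc (suc (a + length as))
  second< = s≤s (s≤s (+-monoʳ-≤ a (length-lower-≤ as)))
  rest< : All (_< suc (a + length (lower as))) (fromOdd k (lower as))
  rest< = All.map s≤s (fromOdd-≤ k (lower-≤ a≥))

fromOdd-positive : ∀ k as → All (_> 0) (fromOdd k as)
fromOdd-positive _       []           = []
fromOdd-positive zero    (_ ∷ _)      = []
fromOdd-positive (suc k) (zero ∷ as)  = z<s ∷ []
fromOdd-positive (suc k) (suc a ∷ as) = z<s ∷ z<s ∷ fromOdd-positive k (lower as)

-- Splitting by parity

double : ℕ → ℕ
double a = a + a

double-%2 : ∀ a → double a % 2 ≡ 0
double-%2 zero    = refl
double-%2 (suc a) rewrite +-suc a a = double-%2 a

oddPart-%2 : ∀ a → oddPart a % 2 ≡ 1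
oddPart-%2 zero    = refl
oddPart-%2 (suc a) rewrite +-suc a a = oddPart-%2 a

Even : ℕ → Set
Even x = x % 2 ≡ 0

even? : U.Decidable Even
even? x = x % 2 ≟ 0

double-⌊n/2⌋ : Even x → double ⌊ x /2⌋ ≡ x
double-⌊n/2⌋ {x} even = begin
  ⌊ x /2⌋ + ⌊ x /2⌋             ≡⟨ cong (λ b → ⌊ x /2⌋ + b) (+-identityʳ _) ⟨
  ⌊ x /2⌋ + (⌊ x /2⌋ + 0)       ≡⟨ cong (λ b → ⌊ x /2⌋ + (⌊ x /2⌋ + b)) even ⟨
  ⌊ x /2⌋ + (⌊ x /2⌋ + x % 2)   ≡⟨ double-half+rem x ⟩
  x                             ∎
  where open ≡-Reasoning

oddPart-⌊n/2⌋ : ¬ Even x → oddPart ⌊ x /2⌋ ≡ x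
oddPart-⌊n/2⌋ {0}           odd = contradiction refl odd
oddPart-⌊n/2⌋ {1}           odd = refl
oddPart-⌊n/2⌋ {suc (suc x)} odd rewrite +-suc ⌊ x /2⌋ ⌊ x /2⌋ =
  cong suc (cong suc (oddPart-⌊n/2⌋ {x} odd))

join : List ℕ → List ℕ → List ℕ
join κ ω = sort (map double κ ++ map oddPart ω)

evens odds : List ℕ → List ℕ
evens xs = map ⌊_/2⌋ (filter even? xs)
odds  xs = map ⌊_/2⌋ (filter (∁? even?) xs)

halve-decreasing : Decreasing xs → Decreasing (map ⌊_/2⌋ xs)
halve-decreasing d = AllPairsₚ.map⁺ (AllPairs.map ⌊n/2⌋-mono d)

evens-decreasing : Decreasing xs → Decreasing (evens xs)
evens-decreasing d = halve-decreasing (AllPairsₚ.filter⁺ even? d)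

odds-decreasing : Decreasing xs → Decreasing (odds xs)
odds-decreasing d = halve-decreasing (AllPairsₚ.filter⁺ (∁? even?) d)

evens-positive : ∀ xs → All (_> 0) xs → All (_> 0) (evens xs)
evens-positive xs pos = Allₚ.map⁺ (All.zipWith (λ {x} (even , x>0) → halve x even x>0)
  (Allₚ.all-filter even? xs , Allₚ.filter⁺ even? pos))
  where
  halve : ∀ x → Even x → 0 < x → 0 < ⌊ x /2⌋
  halve (suc (suc _)) _ _ = z<s

-- Stated for an arbitrary predicate so that exchanging `double` and `oddPart` gives the even and
-- the odd case alike.
filter-map-++-map : ∀ {P : ℕ → Set} (P? : U.Decidable P) {f g : ℕ → ℕ} →
  (∀ a → P (f a)) → (∀ a → ¬ P (g a)) → ∀ as bs →
  filter P? (map f as ++ map g bs) ≡ map f as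
filter-map-++-map P? {f} {g} Pf ¬Pg as bs = begin
  filter P? (map f as ++ map g bs)             ≡⟨ filter-++ P? (map f as) (map g bs) ⟩
  filter P? (map f as) ++ filter P? (map g bs)
    ≡⟨ cong₂ _++_ (filter-all P? (Allₚ.map⁺ (All.universal Pf as)))
                  (filter-none P? (Allₚ.map⁺ (All.universal ¬Pg bs))) ⟩
  map f as ++ []                               ≡⟨ ++-identityʳ _ ⟩
  map f as                                     ∎
  where open ≡-Reasoning

oddPart-odd : ∀ a → ¬ Even (oddPart a)
oddPart-odd a even = 0≢1+n (trans (sym even) (oddPart-%2 a))

filter-even-join : Decreasing κ → filter even? (join κ ω) ≡ map double κ
filter-even-join {κ} {ω} d = ↭⇒≡ (AllPairsₚ.filter⁺ even? (sort-decreasing _))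
  (AllPairsₚ.map⁺ (AllPairs.map (λ a≥b → +-mono-≤ a≥b a≥b) d))
  (↭-trans (filter-↭ even? (sort-↭ (map double κ ++ map oddPart ω)))
    (↭-reflexive (filter-map-++-map even? {double} {oddPart} double-%2 oddPart-odd κ ω)))

filter-odd-join : Decreasing ω → filter (∁? even?) (join κ ω) ≡ map oddPart ω
filter-odd-join {ω} {κ} d = ↭⇒≡ (AllPairsₚ.filter⁺ (∁? even?) (sort-decreasing _))
  (AllPairsₚ.map⁺ (AllPairs.map (λ a≥b → s≤s (+-mono-≤ a≥b a≥b)) d))
  (↭-trans (filter-↭ (∁? even?) (↭-trans (sort-↭ (map double κ ++ map oddPart ω))
                                         (++-comm (map double κ) (map oddPart ω))))
    (↭-reflexive (filter-map-++-map (∁? even?) {oddPart} {double} oddPart-odd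
      (λ a odd → odd (double-%2 a)) ω κ)))

map-inverse : ∀ {f g : ℕ → ℕ} → All (λ x → f (g x) ≡ x) xs → map f (map g xs) ≡ xs
map-inverse {xs} inv = trans (sym (map-∘ xs)) (map-id-local inv)

evens-join : Decreasing κ → evens (join κ ω) ≡ κ
evens-join {κ} {ω} d = trans (cong (map ⌊_/2⌋) (filter-even-join {ω = ω} d))
  (map-inverse (All.universal (sym ∘ n≡⌊n+n/2⌋) κ))

odds-join : Decreasing ω → odds (join κ ω) ≡ ω
odds-join {ω} {κ} d = trans (cong (map ⌊_/2⌋) (filter-odd-join {κ = κ} d))
  (map-inverse (All.universal (sym ∘ n≡⌈n+n/2⌉) ω))

filter-++-∁-↭ : ∀ {P : ℕ → Set} (P? : U.Decidable P) xs → filter P? xs ++ filter (∁? P?) xs ↭ xs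
filter-++-∁-↭ P? [] = ↭-refl
filter-++-∁-↭ P? (x ∷ xs) with does (P? x)
... | true  = prep x (filter-++-∁-↭ P? xs)
... | false = ↭-trans (shift x (filter P? xs) _) (prep x (filter-++-∁-↭ P? xs))

join-evens-odds : Decreasing xs → join (evens xs) (odds xs) ≡ xs
join-evens-odds {xs} d = ↭⇒≡ (sort-decreasing _) d
  (↭-trans (sort-↭ _) (↭-trans (↭-reflexive (cong₂ _++_
    (map-inverse (All.map (λ {x} → double-⌊n/2⌋ {x}) (Allₚ.all-filter even? xs)))
    (map-inverse (All.map (λ {x} → oddPart-⌊n/2⌋ {x}) (Allₚ.all-filter (∁? even?) xs)))))
    (filter-++-∁-↭ even? xs)))

length-join : ∀ κ ω → length (join κ ω) ≡ length κ + length ω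
length-join κ ω = begin
  length (join κ ω)                                ≡⟨ ↭-length (sort-↭ (map double κ ++ map oddPart ω)) ⟩
  length (map double κ ++ map oddPart ω)           ≡⟨ length-++ (map double κ) ⟩
  length (map double κ) + length (map oddPart ω)
    ≡⟨ cong₂ _+_ (length-map double κ) (length-map oddPart ω) ⟩
  length κ + length ω                              ∎
  where open ≡-Reasoning

sum-double : ∀ xs → sum (map double xs) ≡ double (sum xs)
sum-double []       = refl
sum-double (x ∷ xs) rewrite sum-double xs = shuffle x (sum xs)
  where
  shuffle : ∀ x m → x + x + (m + m) ≡ x + m + (x + m)
  shuffle = solve-∀

sum-join : ∀ κ ω → sum (join κ ω) ≡ double (sum κ) + sum (map oddPart ω)
sum-join κ ω = begin
  sum (join κ ω)                               ≡⟨ sum-↭ (sort-↭ (map double κ ++ map oddPart ω)) ⟩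
  sum (map double κ ++ map oddPart ω)          ≡⟨ sum-++ (map double κ) _ ⟩
  sum (map double κ) + sum (map oddPart ω)     ≡⟨ cong (λ m → m + sum (map oddPart ω)) (sum-double κ) ⟩
  double (sum κ) + sum (map oddPart ω)         ∎
  where open ≡-Reasoning

join-positive : ∀ ω → All (_> 0) κ → All (_> 0) (join κ ω)
join-positive {κ} ω pos = All-resp-↭ (↭-sym (sort-↭ (map double κ ++ map oddPart ω)))
  (Allₚ.++⁺ (Allₚ.map⁺ (All.map (λ {a} a>0 → ≤-trans a>0 (m≤m+n a a)) pos))
            (Allₚ.map⁺ (All.universal (λ _ → z<s) ω)))

merge-positive : All (_> 0) μ → All (_> 0) ν → All (_> 0) (merge μ ν)
merge-positive {μ} {ν} μ>0 ν>0 = All-resp-↭ (↭-sym (sort-↭ (μ ++ μ ++ ν)))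
  (Allₚ.++⁺ μ>0 (Allₚ.++⁺ μ>0 ν>0))

-- The correspondence on lists of parts

encode : List ℕ → List ℕ
encode xs = join (conjugate (halves xs)) (toOdd (unpairedParts xs))

decode : List ℕ → List ℕ
decode ys = merge (conjugate (evens ys)) (fromOdd (length (odds ys)) (odds ys))

-- Positivity enters in both components: `conjugate` forgets parts 0, and `fromOdd` never returns
-- one.
decode-encode : Decreasing xs → All (_> 0) xs → decode (encode xs) ≡ xs
decode-encode {xs} d pos = begin
  decode (encode xs)
    ≡⟨ cong₂ (λ κ ω → merge (conjugate κ) (fromOdd (length ω) ω))
         (evens-join {ω = toOdd (unpairedParts xs)} (conjugate-decreasing (halves xs)))
         (odds-join {κ = conjugate (halves xs)} (toOdd-decreasing strict)) ⟩
  merge (conjugate (conjugate (halves xs)))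
        (fromOdd (length (toOdd (unpairedParts xs))) (toOdd (unpairedParts xs)))
    ≡⟨ cong₂ merge (conjugate-involutive (halves-decreasing d) (halves-All pos))
         (fromOdd-toOdd _ strict (unpairedParts-All xs pos) ≤-refl) ⟩
  merge (halves xs) (unpairedParts xs)
    ≡⟨ merge-halves-unpairedParts d ⟩
  xs ∎
  where
  open ≡-Reasoning
  strict : StrictlyDecreasing (unpairedParts xs)
  strict = unpairedParts-strict xs d

encode-decode : Decreasing ys → All (_> 0) ys → encode (decode ys) ≡ ys
encode-decode {ys} d pos = begin
  encode (decode ys)
    ≡⟨ cong₂ (λ μ ν → join (conjugate μ) (toOdd ν))
         (halves-merge (conjugate-decreasing (evens ys)) strict)
         (unpairedParts-merge {μ = conjugate (evens ys)} strict) ⟩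
  join (conjugate (conjugate (evens ys))) (toOdd (fromOdd (length (odds ys)) (odds ys)))
    ≡⟨ cong₂ join (conjugate-involutive (evens-decreasing d) (evens-positive ys pos))
         (toOdd-fromOdd _ (odds-decreasing d) ≤-refl) ⟩
  join (evens ys) (odds ys)
    ≡⟨ join-evens-odds d ⟩
  ys ∎
  where
  open ≡-Reasoning
  strict : StrictlyDecreasing (fromOdd (length (odds ys)) (odds ys))
  strict = fromOdd-strict _ (odds-decreasing d)

-- The halves count twice in `merge` because they occur twice, and twice in `join` because the parts
-- of their conjugate are doubled.
sum-encode : Decreasing xs → sum (encode xs) ≡ sum xs
sum-encode {xs} d = begin
  sum (encode xs)
    ≡⟨ sum-join (conjugate (halves xs)) (toOdd (unpairedParts xs)) ⟩
  double (sum (conjugate (halves xs))) + sum (map oddPart (toOdd (unpairedParts xs)))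
    ≡⟨ cong₂ (λ m l → double m + l) (sum-conjugate (halves xs)) (sum-toOdd (unpairedParts-strict xs d)) ⟩
  double (sum (halves xs)) + sum (unpairedParts xs)
    ≡⟨ +-assoc (sum (halves xs)) _ _ ⟩
  sum (halves xs) + (sum (halves xs) + sum (unpairedParts xs))
    ≡⟨ sum-merge (halves xs) (unpairedParts xs) ⟨
  sum (merge (halves xs) (unpairedParts xs))
    ≡⟨ cong sum (merge-halves-unpairedParts d) ⟩
  sum xs ∎
  where open ≡-Reasoning

length-encode : Decreasing xs →
  + length (encode xs) ≡ + max 0 (pairedParts xs) ℤ.+ alternatingSum (unpairedParts xs)
length-encode {xs} d = begin
  + length (encode xs)
    ≡⟨ cong +_ (length-join (conjugate (halves xs)) (toOdd (unpairedParts xs))) ⟩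
  + length (conjugate (halves xs)) ℤ.+ + length (toOdd (unpairedParts xs))
    ≡⟨ cong₂ ℤ._+_ (cong +_ (trans (length-conjugate (halves-decreasing d)) (sym (max-pairedParts xs))))
                   (sym (alternatingSum-toOdd (unpairedParts-strict xs d))) ⟩
  + max 0 (pairedParts xs) ℤ.+ alternatingSum (unpairedParts xs) ∎
  where open ≡-Reasoning

-- Partitions as records and the fibres of the two statistics

partition-≡ : {p q : Partition n} → parts p ≡ parts q → p ≡ q
partition-≡ {p = record { decreasing = d ; positive = p ; sum-parts = s₁ }}
            {record { decreasing = d′ ; positive = p′ ; sum-parts = s₂ }} refl
  with refl ← Linked.irrelevant ≤-irrelevant d d′
     | refl ← All.irrelevant ≤-irrelevant p p′
     | refl ← ≡-irrelevant s₁ s₂ = refl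

decreasing′ : (p : Partition n) → Decreasing (parts p)
decreasing′ p = Linked⇒AllPairs (flip ≤-trans) (decreasing p)

encodePartition : Partition n → Partition n
encodePartition p = record
  { parts      = encode (parts p)
  ; decreasing = AllPairs⇒Linked (sort-decreasing _)
  ; positive   = join-positive (toOdd (unpairedParts (parts p))) (conjugate-positive (halves (parts p)))
  ; sum-parts  = trans (sum-encode (decreasing′ p)) (sum-parts p)
  }

decodePartition : Partition n → Partition n
decodePartition p = record
  { parts      = decode (parts p)
  ; decreasing = AllPairs⇒Linked (sort-decreasing _)
  ; positive   = merge-positive (conjugate-positive (evens (parts p)))
                                (fromOdd-positive (length (odds (parts p))) (odds (parts p)))
  ; sum-parts  = begin
      -- `decode` yields a decreasing list, so `sum-encode` read backwards gives its sum without any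
      -- computation for `fromOdd`.
      sum (decode (parts p))            ≡⟨ sum-encode (sort-decreasing _) ⟨
      sum (encode (decode (parts p)))   ≡⟨ cong sum (encode-decode (decreasing′ p) (positive p)) ⟩
      sum (parts p)                     ≡⟨ sum-parts p ⟩
      _                                 ∎
  }
  where open ≡-Reasoning

encodePartition-decodePartition : (p : Partition n) → encodePartition (decodePartition p) ≡ p
encodePartition-decodePartition p = partition-≡ (encode-decode (decreasing′ p) (positive p))

decodePartition-encodePartition : (p : Partition n) → decodePartition (encodePartition p) ≡ p
decodePartition-encodePartition p = partition-≡ (decode-encode (decreasing′ p) (positive p))

numberOfParts-encodePartition : (p : Partition n) → + numberOfParts (encodePartition p) ≡ pairingIndex p
numberOfParts-encodePartition p = length-encode (decreasing′ p)

Σ-subset-≡ : ∀ {A : Set} {P : A → Set} → (∀ {x} (p q : P x) → p ≡ q) →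
  ∀ {u v : Σ[ x ∈ A ] P x} → proj₁ u ≡ proj₁ v → u ≡ v
Σ-subset-≡ irr {x , p} {_ , q} refl = cong (_,_ x) (irr p q)

-- A bijection carrying one statistic to the other matches their fibres. The equations stored in the
-- fibres live in ℤ and ℕ, where equality proofs are unique, so the round trips need only agree on
-- the underlying elements.
fibre-↔ : ∀ {A B : Set} {f : A → B} {g : B → A} {s′ : A → ℤ.ℤ} {t : B → ℕ} →
  (∀ b → f (g b) ≡ b) → (∀ a → g (f a) ≡ a) → (∀ a → + t (f a) ≡ s′ a) →
  ∀ k → (Σ[ a ∈ A ] s′ a ≡ + k) ↔ (Σ[ b ∈ B ] t b ≡ k)
fibre-↔ {f = f} {g} {t = t} f∘g g∘f t∘f k = mk↔ₛ′
  (λ (a , eq) → f a , ℤₚ.+-injective (trans (t∘f a) eq))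
  (λ (b , eq) → g b , trans (sym (t∘f (g b))) (cong +_ (trans (cong t (f∘g b)) eq)))
  (λ (b , _) → Σ-subset-≡ ≡-irrelevant (f∘g b))
  (λ (a , _) → Σ-subset-≡ (Decidable⇒UIP.≡-irrelevant ℤₚ._≟_) (g∘f a))

pairingIndex↔numberOfParts : ∀ n k →
  (Σ[ p ∈ Partition n ] pairingIndex p ≡ + k) ↔ (Σ[ p ∈ Partition n ] numberOfParts p ≡ k)
pairingIndex↔numberOfParts n = fibre-↔ {f = encodePartition} {g = decodePartition}
  {s′ = pairingIndex} {t = numberOfParts} encodePartition-decodePartition
  decodePartition-encodePartition numberOfParts-encodePartition

-- Finiteness and the common cardinality

module _ {A : Set} where

  -- The membership proof comes from filtering and deduplicating, so its position is not known by
  -- computation; absence of repetitions forces it.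
  index-unique : {xs : List A} → Unique xs → ∀ i (x∈xs : lookup xs i ∈ xs) → Any.index x∈xs ≡ i
  index-unique (_  ∷ _) Fin.zero    (here _)     = refl
  index-unique (x≢ ∷ _) Fin.zero    (there x∈xs) = contradiction refl (All.lookup x≢ x∈xs)
  index-unique (x≢ ∷ _) (Fin.suc i) (here eq)    = contradiction (sym eq) (All.lookup x≢ (∈-lookup i))
  index-unique (_  ∷ u) (Fin.suc i) (there x∈xs) = cong Fin.suc (index-unique u i x∈xs)

  subset-finite : DecidableEquality A → {P : A → Set} → U.Decidable P → U.Irrelevant P →
    (xs : List A) → (∀ {x} → P x → x ∈ xs) → ∃[ N ] HasCardinality (Σ[ x ∈ A ] P x) N
  subset-finite _≟A_ {P} P? irr xs complete = length elements , mk↔ₛ′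
    (λ (_ , px) → Any.index (∈-elements px))
    (λ i → lookup elements i , satisfies i)
    (λ i → index-unique unique i (∈-elements (satisfies i)))
    (λ (_ , px) → Σ-subset-≡ irr (sym (lookup-index (∈-elements px))))
    where
    elements : List A
    elements = filter P? (deduplicate _≟A_ xs)
    ∈-elements : ∀ {x} → P x → x ∈ elements
    ∈-elements px = ∈-filter⁺ P? (∈-deduplicate⁺ _≟A_ (complete px)) px
    satisfies : ∀ i → P (lookup elements i)
    satisfies i = proj₂ (∈-filter⁻ P? {xs = deduplicate _≟A_ xs} (∈-lookup i))
    unique : Unique elements
    unique = Uniqueₚ.filter⁺ P? (deduplicate-! _≟A_ xs)

-- A crude finite superset of the partitions of `b` into `k` parts: order and positivity are left to
-- the filter in `subset-finite`.
boundedLists : ℕ → ℕ → List (List ℕ)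
boundedLists b zero    = [] ∷ []
boundedLists b (suc k) = cartesianProductWith _∷_ (upTo (suc b)) (boundedLists b k)

∈-boundedLists : All (_≤ b) xs → xs ∈ boundedLists b (length xs)
∈-boundedLists []         = here refl
∈-boundedLists (x≤b ∷ ≤b) = ∈-cartesianProductWith⁺ _∷_ (∈-upTo⁺ (s≤s x≤b)) (∈-boundedLists ≤b)

parts-≤-sum : ∀ xs → All (_≤ sum xs) xs
parts-≤-sum []       = []
parts-≤-sum (x ∷ xs) = m≤m+n x _ ∷ All.map (λ y≤ → ≤-trans y≤ (m≤n+m _ x)) (parts-≤-sum xs)

-- The fibre is restated as a predicate on bare lists, which have decidable equality and can be
-- enumerated.
IsPartition : ℕ → ℕ → List ℕ → Set
IsPartition n k xs = Linked _≥_ xs × All (_> 0) xs × sum xs ≡ n × length xs ≡ k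

isPartition? : ∀ n k → U.Decidable (IsPartition n k)
isPartition? n k xs = Linked.linked? _≥?_ xs ×-dec All.all? (0 <?_) xs ×-dec
                      sum xs ≟ n ×-dec length xs ≟ k

isPartition-irrelevant : U.Irrelevant (IsPartition n k)
isPartition-irrelevant (d , p , s₁ , l) (d′ , p′ , s₂ , l′)
  with refl ← Linked.irrelevant ≤-irrelevant d d′
     | refl ← All.irrelevant ≤-irrelevant p p′
     | refl ← ≡-irrelevant s₁ s₂
     | refl ← ≡-irrelevant l l′ = refl

isPartition-bounded : IsPartition n k xs → xs ∈ boundedLists n k
isPartition-bounded {xs = xs} (_ , _ , refl , refl) = ∈-boundedLists (parts-≤-sum xs)

numberOfParts-finite : ∀ n k → ∃[ N ] HasCardinality (Σ[ p ∈ Partition n ] numberOfParts p ≡ k) N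
numberOfParts-finite n k
  with N , lists↔Fin ← subset-finite (≡-dec _≟_) (isPartition? n k) isPartition-irrelevant
                         (boundedLists n k) isPartition-bounded
  = N , (lists↔Fin ↔-∘ mk↔ₛ′
      (λ (p , len) → parts p , decreasing p , positive p , sum-parts p , len)
      (λ (xs , d , pos , sum≡n , len) →
        record { parts = xs ; decreasing = d ; positive = pos ; sum-parts = sum≡n } , len)
      (λ _ → refl) (λ _ → refl))

theorem2p1 : (n k : ℕ) →
    ∃[ N ] HasCardinality (Σ[ p ∈ Partition n ] pairingIndex p ≡ + k) N
         × HasCardinality (Σ[ p ∈ Partition n ] numberOfParts p ≡ k) N
-- `N` comes from enumerating partitions by number of parts; the bijection transfers it to the fibre
-- of the pairing index.
theorem2p1 n k with N , finite ← numberOfParts-finite n k =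
  N , (finite ↔-∘ pairingIndex↔numberOfParts n k) , finite
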